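{- Let $G$ be a graph and let $G_{\mathrm{R\text{ - }core}}$ be an R-core of $G$. Then $G_{\mathrm{R\text{ - }core}}$ is isomorphic to an induced subgraph of $G$.
   Context: Graphs are finite and undirected, with loops allowed: $G=(V_G,E_G)$ with $E_G\subseteq V_G\times V_G$ symmetric. A relation $R\subseteq X\times Y$ has full domain if every $x\in X$ is related to some $p\in Y$, and full image if every $p\in Y$ is related to by some $x\in X$. For a graph $G$, a finite set $B$ and a relation $R\subseteq V_G\times B$ with full image, $G\ast R$ is the graph with vertex set $B$ and edge set $\{(u,v)\in B\times B : \text{there is } (x,y)\in E_G \text{ with } (x,u),(y,v)\in R\}$. The equation $G\ast R=H$ means that $R\subseteq V_G\times V_H$ has full image and $G\ast R$ equals $H$ as a graph. Graphs $G,H$ are weakly relationally equivalent, $G\backsim_w H$, if there are relations $R\subseteq V_G\times V_H$ and $S\subseteq V_H\times V_G$, both with full domain, such that $G\ast R=H$ and $H\ast S=G$. A graph is an R-core if it has the smallest number of vertices among all graphs in its $\backsim_w$-equivalence class. $H$ is an R-core of $G$ if $H$ is an R-core and $H\backsim_w G$; it is unique up to isomorphism and is denoted $G_{\mathrm{R\text{ - }core}}$. -}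

module Defs where

open import Data.Bool using (Bool; true; false; T)
open import Data.Fin using (Fin; zero; suc)
open import Data.Fin.Properties using (any?; 0↔⊥; 1↔⊤; +↔⊎)
open import Data.Nat using (ℕ; zero; suc; _+_; _≤_)
open import Data.Product using (Σ-syntax; ∃; ∃-syntax; _×_; _,_; proj₁; proj₂)
open import Data.Product.Function.Dependent.Propositional using (cong)
open import Data.Sum using (_⊎_; inj₁; inj₂)
open import Data.Sum.Function.Propositional using (_⊎-↔_)
open import Function using (_∘_; _on_)
open import Function.Bundles using (_↔_; _⇔_; Inverse; mk↔ₛ′)
open import Function.Related.Propositional using (≡⇒)
open import Function.Properties.Inverse using (↔-sym; ↔-trans)
open import Level using (0ℓ)
open import Relation.Binary.Core using (Rel; REL) renaming (_⇔_ to _≐_)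
open import Relation.Binary.Definitions using (Symmetric; Decidable)
open import Relation.Binary.PropositionalEquality using (refl; sym; subst) renaming (cong to ≡-cong)
open import Relation.Nullary using (Dec)
open import Relation.Nullary.Decidable using (map′; _×-dec_)
import Relation.Unary as Unary

record FiniteSet : Set₁ where
  field
    Carrier : Set
    size    : ℕ
    enum    : Carrier ↔ Fin size

open FiniteSet public using () renaming (Carrier to ⟨_⟩; size to ∣_∣)

any-finite? : (A : FiniteSet) {P : Unary.Pred ⟨ A ⟩ 0ℓ} → Unary.Decidable P → Dec (∃ P)
any-finite? A {P} P? = map′
  (λ (i , p) → from i , p)
  (λ (x , p) → to x , subst P (sym (strictlyInverseʳ x)) p)
  (any? (λ i → P? (from i)))
  where open Inverse (FiniteSet.enum A)

-- A subset of A × B; decidability of membership is automatic classically.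
record Relation (A B : FiniteSet) : Set₁ where
  field
    rel  : REL ⟨ A ⟩ ⟨ B ⟩ 0ℓ
    rel? : Decidable rel

open Relation public

FullDomain : ∀ {A B} → Relation A B → Set
FullDomain R = ∀ x → ∃[ p ] rel R x p

FullImage : ∀ {A B} → Relation A B → Set
FullImage R = ∀ p → ∃[ x ] rel R x p

-- Loops are allowed: the edge relation need not be irreflexive.
record Graph : Set₁ where
  field
    V     : FiniteSet
    edges : Relation V V
    E-sym : Symmetric (rel edges)

  E : Rel ⟨ V ⟩ 0ℓ
  E = rel edges

  E? : Decidable E
  E? = rel? edges

open Graph public

-- Defined for every R; the requirement of full image is part of Transforms below.
_∗_ : (G : Graph) {B : FiniteSet} → Relation (V G) B → Graph
_∗_ G {B} R = record
  { V     = B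
  ; edges = record
    { rel  = λ u v → ∃[ x ] ∃[ y ] E G x y × rel R x u × rel R y v
    ; rel? = λ u v → any-finite? (V G) λ x → any-finite? (V G) λ y →
               E? G x y ×-dec rel? R x u ×-dec rel? R y v
    }
  ; E-sym = λ (x , y , e , r , s) → y , x , E-sym G e , s , r
  }

-- The equation G ∗ R = H.  Both sides have vertex set V H by typing, so that equality
-- of graphs is equality of the edge sets (mutual inclusion).
Transforms : (G H : Graph) → Relation (V G) (V H) → Set
Transforms G H R = FullImage R × (E (G ∗ R) ≐ E H)

infix 4 _∼ʷ_ _≅_

_∼ʷ_ : Graph → Graph → Set₁
G ∼ʷ H =
  (Σ[ R ∈ Relation (V G) (V H) ] FullDomain R × Transforms G H R) ×
  (Σ[ S ∈ Relation (V H) (V G) ] FullDomain S × Transforms H G S)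

IsRCore : Graph → Set₁
IsRCore G = ∀ K → K ∼ʷ G → ∣ V G ∣ ≤ ∣ V K ∣

_IsRCoreOf_ : Graph → Graph → Set₁
H IsRCoreOf G = IsRCore H × H ∼ʷ G

record _≅_ (G H : Graph) : Set where
  field
    bij       : ⟨ V G ⟩ ↔ ⟨ V H ⟩
    preserves : ∀ x y → E G x y ⇔ E H (Inverse.to bij x) (Inverse.to bij y)

private
  bit : Bool → ℕ
  bit true  = 1
  bit false = 0

  T↔bit : ∀ b → T b ↔ Fin (bit b)
  T↔bit true  = ↔-sym 1↔⊤
  T↔bit false = ↔-sym 0↔⊥

  count : ∀ {n} → (Fin n → Bool) → ℕ
  count {zero}  b = 0
  count {suc n} b = bit (b zero) + count (b ∘ suc)

  Σ-suc↔⊎ : ∀ {n} {P : Fin (suc n) → Set} → ∃ P ↔ (P zero ⊎ ∃ (P ∘ suc))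
  Σ-suc↔⊎ = mk↔ₛ′
    (λ { (zero , p) → inj₁ p ; (suc i , p) → inj₂ (i , p) })
    (λ { (inj₁ p) → zero , p ; (inj₂ (i , p)) → suc i , p })
    (λ { (inj₁ _) → refl ; (inj₂ _) → refl })
    (λ { (zero , _) → refl ; (suc _ , _) → refl })

  enum-subset : ∀ {n} (b : Fin n → Bool) → ∃ (T ∘ b) ↔ Fin (count b)
  enum-subset {zero}  b = mk↔ₛ′ (λ { (() , _) }) (λ ()) (λ ()) (λ { (() , _) })
  enum-subset {suc n} b = ↔-trans Σ-suc↔⊎
    (↔-trans (T↔bit (b zero) ⊎-↔ enum-subset (b ∘ suc)) (↔-sym +↔⊎))

-- The elements of A with characteristic function U; T (U x) has at most one
-- proof, so each element is counted once.
Subset : (A : FiniteSet) → (⟨ A ⟩ → Bool) → FiniteSet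
Subset A U = record
  { Carrier = Σ[ x ∈ ⟨ A ⟩ ] T (U x)
  ; size    = count (U ∘ from)
  ; enum    = ↔-trans
      (cong (FiniteSet.enum A) λ {x} → ≡⇒ (≡-cong (T ∘ U) (sym (strictlyInverseʳ x))))
      (enum-subset (U ∘ from))
  }
  where open Inverse (FiniteSet.enum A)

_[_] : (G : Graph) → (⟨ V G ⟩ → Bool) → Graph
G [ U ] = record
  { V     = Subset (V G) U
  ; edges = record
    { rel  = E G on proj₁
    ; rel? = λ x y → E? G (proj₁ x) (proj₁ y)
    }
  ; E-sym = E-sym G
  }

-- Let T = S ∘ R, where C ∗ R = G and G ∗ S = C, so that C ∗ T = C.  A vertex
-- cover of T with fewer than |C| elements would factor C ∗ T = C through a
-- smaller graph weakly equivalent to C; hence, by König's theorem, T contains a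
-- permutation π, and π x is reached from x through some vertex g x of G.  Now g
-- is a homomorphism and edges g x – g y of G give edges π x – π y of C, so π is
-- an automorphism and g reflects edges.  If g x = g y, then x and y have the
-- same neighbours, which forces x = y, as twins could be identified in C.

module Submission where

open import Defs
open import Data.Bool.Properties using (T-irrelevant)
open import Data.Empty using (⊥-elim)
open import Data.Fin using (Fin; zero; suc; toℕ)
open import Data.Fin.Properties using (_≟_; pigeonhole; inj⇒≟; +↔⊎; *↔×)
open import Data.Fin.Subset as Sub using (inside; outside; _∈_; _∪_; _∩_; ⁅_⁆; ⊤; ⊥; _-_)
open import Data.Fin.Subset.Properties
  using (∈⊤; ∣⊤∣≡n; ∣⊥∣≡0; ∣⁅x⁆∣≡1; x∈⁅x⁆; x∈p∩q⁺; x∈p∪q⁺; x∈p∧x≢y⇒x∈p-y; x∈p⇒∣p-x∣<∣p∣)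
open import Data.List using (List; []; _∷_; allFin)
open import Data.List.Membership.Propositional using () renaming (_∈_ to _∈ˡ_)
open import Data.List.Membership.Propositional.Properties using (∈-allFin)
open import Data.List.Relation.Unary.Any using (here; there)
open import Data.Nat using (ℕ; zero; suc; _+_; _*_; _≤_; _<_; _<?_; s≤s; s≤s⁻¹; s<s; s<s⁻¹)
open import Data.Nat.GeneralisedArithmetic using (fold)
open import Data.Nat.Properties
  using (+-suc; +-identityʳ; +-monoʳ-≤; +-mono-≤; +-cancelˡ-≤; +-monoˡ-≤; m≤m+n;
         ≤-reflexive; ≮⇒≥; <⇒≱; n<1+n; module ≤-Reasoning)
open import Data.Nat.Tactic.RingSolver using (solve-∀)
open import Data.Product using (Σ-syntax; ∃-syntax; _×_; _,_; proj₁; proj₂; map; uncurry)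
open import Data.Product.Function.NonDependent.Propositional using (_×-↔_)
open import Data.Product.Properties using (,-injective; Σ-≡,≡→≡)
open import Data.Sum using (_⊎_; inj₁; inj₂; [_,_]; [_,_]′)
import Data.Sum as Sum
open import Data.Vec using ([]; _∷_; here; there)
open import Function using (_∘_; id; Injective)
open import Function.Bundles using (_↔_; _↣_; _⇔_; mk⇔; mk↔ₛ′; Inverse; Injection)
open import Function.Properties.Inverse using (↔-refl; ↔-sym; ↔-trans; ↔⇒↣)
open import Level using (0ℓ)
open import Relation.Binary.Core using (REL)
open import Relation.Binary.Definitions using (Decidable; DecidableEquality)
open import Relation.Binary.PropositionalEquality
  using (_≡_; _≢_; refl; sym; trans; cong; cong₂; subst; subst₂)
open import Relation.Nullary using (Dec; yes; no; ¬_; contradiction)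
open import Relation.Nullary.Decidable using (⌊_⌋; _×-dec_; _⊎-dec_; ¬?; toWitness; fromWitness)

private variable
  k m n : ℕ

-- Cardinalities and enumerations of subsets of `Fin n`

∣p∪q∣+∣p∩q∣ : (p q : Sub.Subset n) → Sub.∣ p ∪ q ∣ + Sub.∣ p ∩ q ∣ ≡ Sub.∣ p ∣ + Sub.∣ q ∣
∣p∪q∣+∣p∩q∣ []            []            = refl
∣p∪q∣+∣p∩q∣ (outside ∷ p) (outside ∷ q) = ∣p∪q∣+∣p∩q∣ p q
∣p∪q∣+∣p∩q∣ (outside ∷ p) (inside  ∷ q) =
  trans (cong suc (∣p∪q∣+∣p∩q∣ p q)) (sym (+-suc _ _))
∣p∪q∣+∣p∩q∣ (inside  ∷ p) (outside ∷ q) = cong suc (∣p∪q∣+∣p∩q∣ p q)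
∣p∪q∣+∣p∩q∣ (inside  ∷ p) (inside  ∷ q) = cong suc
  (trans (+-suc _ _) (trans (cong suc (∣p∪q∣+∣p∩q∣ p q)) (sym (+-suc _ _))))

∣p∪⁅x⁆∣≤1+∣p∣ : (p : Sub.Subset n) (x : Fin n) → Sub.∣ p ∪ ⁅ x ⁆ ∣ ≤ suc Sub.∣ p ∣
∣p∪⁅x⁆∣≤1+∣p∣ p x = begin
  Sub.∣ p ∪ ⁅ x ⁆ ∣                      ≤⟨ m≤m+n _ _ ⟩
  Sub.∣ p ∪ ⁅ x ⁆ ∣ + Sub.∣ p ∩ ⁅ x ⁆ ∣  ≡⟨ ∣p∪q∣+∣p∩q∣ p ⁅ x ⁆ ⟩
  Sub.∣ p ∣ + Sub.∣ ⁅ x ⁆ ∣              ≡⟨ cong (Sub.∣ p ∣ +_) (∣⁅x⁆∣≡1 x) ⟩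
  Sub.∣ p ∣ + 1                          ≡⟨ +-suc _ 0 ⟩
  suc (Sub.∣ p ∣ + 0)                    ≡⟨ cong suc (+-identityʳ _) ⟩
  suc Sub.∣ p ∣                          ∎
  where open ≤-Reasoning

enumerate : (p : Sub.Subset n) →
  Σ[ e ∈ (Fin Sub.∣ p ∣ → Fin n) ] (∀ {x} → x ∈ p → ∃[ i ] e i ≡ x)
enumerate []            = (λ ()) , λ ()
enumerate (outside ∷ p) with e , hits ← enumerate p =
  suc ∘ e , λ { (there x∈p) → map id (cong suc) (hits x∈p) }
enumerate (inside  ∷ p) with e , hits ← enumerate p =
  (λ { zero → zero ; (suc i) → suc (e i) }) ,
  λ { here → zero , refl ; (there x∈p) → map suc (cong suc) (hits x∈p) }

-- König's theorem

-- Saturates the rows; for `m = n` the injection is a permutation contained in `T`.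
Matching : REL (Fin m) (Fin n) 0ℓ → Set
Matching T = ∃[ f ] Injective _≡_ _≡_ f × (∀ x → T x (f x))

-- The bound is strict because a cover with fewer than `m` elements is exactly what obstructs a
-- matching of all `m` rows.
record Cover (T : REL (Fin m) (Fin n) 0ℓ) (k : ℕ) : Set where
  field
    rows   : Sub.Subset m
    cols   : Sub.Subset n
    covers : ∀ {x y} → T x y → x ∈ rows ⊎ y ∈ cols
    size<  : Sub.∣ rows ∣ + Sub.∣ cols ∣ < k

open Cover

-- Covers form a lattice on which the size is modular: if the join is not
-- smaller than k, then the meet is at most k.
mergeCovers : {T : REL (Fin m) (Fin n) 0ℓ} (c d : Cover T (suc k)) →
  Cover T k ⊎ (Σ[ e ∈ Cover T (suc k) ] cols e ≡ cols c ∪ cols d)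
mergeCovers {k = k} c d
  with Sub.∣ rows c ∪ rows d ∣ + Sub.∣ cols c ∩ cols d ∣ <? k
... | yes small = inj₁ record
  { rows   = rows c ∪ rows d
  ; cols   = cols c ∩ cols d
  ; covers = λ t → join (covers c t) (covers d t)
  ; size<  = small
  }
  where
  join : ∀ {x y} → x ∈ rows c ⊎ y ∈ cols c → x ∈ rows d ⊎ y ∈ cols d →
         x ∈ rows c ∪ rows d ⊎ y ∈ cols c ∩ cols d
  join (inj₁ x∈c) _          = inj₁ (x∈p∪q⁺ (inj₁ x∈c))
  join (inj₂ _)   (inj₁ x∈d) = inj₁ (x∈p∪q⁺ (inj₂ x∈d))
  join (inj₂ y∈c) (inj₂ y∈d) = inj₂ (x∈p∩q⁺ (y∈c , y∈d))
... | no ¬small = inj₂ (record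
  { rows   = rows c ∩ rows d
  ; cols   = cols c ∪ cols d
  ; covers = λ t → meet (covers c t) (covers d t)
  ; size<  = s≤s (+-cancelˡ-≤ k _ _ bound)
  } , refl)
  where
  meet : ∀ {x y} → x ∈ rows c ⊎ y ∈ cols c → x ∈ rows d ⊎ y ∈ cols d →
         x ∈ rows c ∩ rows d ⊎ y ∈ cols c ∪ cols d
  meet (inj₁ x∈c) (inj₁ x∈d) = inj₁ (x∈p∩q⁺ (x∈c , x∈d))
  meet (inj₁ _)   (inj₂ y∈d) = inj₂ (x∈p∪q⁺ (inj₂ y∈d))
  meet (inj₂ y∈c) _          = inj₂ (x∈p∪q⁺ (inj₁ y∈c))

  regroup : ∀ a b c d → (a + b) + (c + d) ≡ (a + c) + (d + b)
  regroup = solve-∀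

  interchange : ∀ a b c d → (a + b) + (c + d) ≡ (a + c) + (b + d)
  interchange = solve-∀

  open ≤-Reasoning
  r∪ r∩ c∪ c∩ : ℕ
  r∪ = Sub.∣ rows c ∪ rows d ∣
  r∩ = Sub.∣ rows c ∩ rows d ∣
  c∪ = Sub.∣ cols c ∪ cols d ∣
  c∩ = Sub.∣ cols c ∩ cols d ∣

  bound : k + (r∩ + c∪) ≤ k + k
  bound = begin
    k + (r∩ + c∪)          ≤⟨ +-monoˡ-≤ _ (≮⇒≥ ¬small) ⟩
    (r∪ + c∩) + (r∩ + c∪)  ≡⟨ regroup r∪ c∩ r∩ c∪ ⟩
    (r∪ + r∩) + (c∪ + c∩)
      ≡⟨ cong₂ _+_ (∣p∪q∣+∣p∩q∣ (rows c) (rows d)) (∣p∪q∣+∣p∩q∣ (cols c) (cols d)) ⟩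
    (Sub.∣ rows c ∣ + Sub.∣ rows d ∣) + (Sub.∣ cols c ∣ + Sub.∣ cols d ∣)
      ≡⟨ interchange Sub.∣ rows c ∣ _ _ _ ⟩
    (Sub.∣ rows c ∣ + Sub.∣ cols c ∣) + (Sub.∣ rows d ∣ + Sub.∣ cols d ∣)
      ≤⟨ +-mono-≤ (s≤s⁻¹ (size< c)) (s≤s⁻¹ (size< d)) ⟩
    k + k                  ∎

-- Deleting a column lowers the cover size by at most one: putting `y` back covers every deleted
-- edge.
addColumn : {T : REL (Fin m) (Fin n) 0ℓ} (y : Fin n) →
  (c : Cover (λ x z → T x z × z ≢ y) k) → Σ[ d ∈ Cover T (suc k) ] y ∈ cols d
addColumn {k = k} {T = T} y c = record
  { rows   = rows c
  ; cols   = cols c ∪ ⁅ y ⁆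
  ; covers = covers′
  ; size<  = s≤s (begin
      Sub.∣ rows c ∣ + Sub.∣ cols c ∪ ⁅ y ⁆ ∣
        ≤⟨ +-monoʳ-≤ Sub.∣ rows c ∣ (∣p∪⁅x⁆∣≤1+∣p∣ (cols c) y) ⟩
      Sub.∣ rows c ∣ + suc Sub.∣ cols c ∣    ≡⟨ +-suc _ _ ⟩
      suc (Sub.∣ rows c ∣ + Sub.∣ cols c ∣)  ≤⟨ size< c ⟩
      k                                      ∎)
  } , x∈p∪q⁺ (inj₂ (x∈⁅x⁆ y))
  where
  open ≤-Reasoning
  covers′ : ∀ {x z} → T x z → x ∈ rows c ⊎ z ∈ cols c ∪ ⁅ y ⁆
  covers′ {z = z} t with z ≟ y
  ... | yes refl = inj₂ (x∈p∪q⁺ (inj₂ (x∈⁅x⁆ y)))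
  ... | no  z≢y  = Sum.map₂ (x∈p∪q⁺ ∘ inj₁) (covers c (t , z≢y))

addRow : {T : REL (Fin (suc m)) (Fin n) 0ℓ} → Cover (T ∘ suc) k → Cover T (suc k)
addRow c = record
  { rows   = inside ∷ rows c
  ; cols   = cols c
  ; covers = λ { {zero} _ → inj₁ here ; {suc x} t → Sum.map₁ there (covers c t) }
  ; size<  = s<s (size< c)
  }

extendMatching : {T : REL (Fin (suc m)) (Fin n) 0ℓ} {y : Fin n} → T zero y →
  Matching (λ x z → T (suc x) z × z ≢ y) → Matching T
extendMatching {T = T} {y} t (f , f-inj , f⊆T) = f′ , f′-inj , f′⊆T
  where
  f′ : Fin _ → Fin _
  f′ zero    = y
  f′ (suc x) = f x

  f′-inj : Injective _≡_ _≡_ f′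
  f′-inj {zero}  {zero}  _  = refl
  f′-inj {zero}  {suc v} eq = ⊥-elim (proj₂ (f⊆T v) (sym eq))
  f′-inj {suc u} {zero}  eq = ⊥-elim (proj₂ (f⊆T u) eq)
  f′-inj {suc u} {suc v} eq = cong suc (f-inj eq)

  f′⊆T : ∀ x → T x (f′ x)
  f′⊆T zero    = t
  f′⊆T (suc x) = proj₁ (f⊆T x)

-- Either some neighbour y of the first row extends a matching of the other
-- rows, or each y lies in a cover of the other rows of size at most m; merging
-- these gives such a cover containing all y, which also covers the first row.
könig : {T : REL (Fin m) (Fin n) 0ℓ} → Decidable T → Matching T ⊎ Cover T m
könig {zero}          T? = inj₁ ((λ ()) , (λ { {()} }) , λ ())
könig {suc m} {n} {T} T? = [ id , inj₂ ∘ coverFirst ] (absorb (allFin n))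
  where
  absorb : (ys : List (Fin n)) → (Matching T ⊎ Cover T (suc m)) ⊎
    (Σ[ c ∈ Cover (T ∘ suc) (suc m) ] (∀ {y} → y ∈ˡ ys → T zero y → y ∈ cols c))
  -- All `m` remaining rows and no column: size exactly `m`, the largest that the bound allows.
  absorb [] = inj₂ (record
    { rows   = ⊤
    ; cols   = ⊥
    ; covers = λ _ → inj₁ ∈⊤
    ; size<  = s≤s (≤-reflexive (trans (cong₂ _+_ (∣⊤∣≡n m) (∣⊥∣≡0 n)) (+-identityʳ m)))
    } , λ ())
  absorb (y ∷ ys) with absorb ys | T? zero y
  ... | inj₁ done    | _     = inj₁ done
  ... | inj₂ (c , h) | no ¬t =
    inj₂ (c , λ { (here refl) t → contradiction t ¬t ; (there z∈ys) → h z∈ys })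
  ... | inj₂ (c , h) | yes t
    -- Matching the first row with `y` leaves one row fewer and forbids column `y`. A cover of what
    -- is left has fewer than `m` elements, so `y` can be added to it.
    with könig {m} {n} {λ x z → T (suc x) z × z ≢ y} (λ x z → T? (suc x) z ×-dec ¬? (z ≟ y))
  ... | inj₁ M = inj₁ (inj₁ (extendMatching {T = T} t M))
  ... | inj₂ d with addColumn y d
  ... | d′ , y∈d′ with mergeCovers c d′
  ... | inj₁ small    = inj₁ (inj₂ (addRow small))
  ... | inj₂ (e , eq) = inj₂ (e , λ
    { (here refl)  _ → subst (y ∈_) (sym eq) (x∈p∪q⁺ (inj₂ y∈d′))
    ; (there z∈ys) t → subst (_ ∈_) (sym eq) (x∈p∪q⁺ (inj₁ (h z∈ys t)))
    })

  coverFirst : (Σ[ c ∈ Cover (T ∘ suc) (suc m) ] (∀ {y} → y ∈ˡ allFin n → T zero y → y ∈ cols c)) →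
    Cover T (suc m)
  coverFirst (c , h) = record
    { rows   = outside ∷ rows c
    ; cols   = cols c
    ; covers = λ { {zero} t → inj₂ (h (∈-allFin _) t) ; {suc x} t → Sum.map₁ there (covers c t) }
    ; size<  = size< c
    }

-- Finite sets

-- Injectivity cancels the first `i` applications on both sides.
fold-returns : {A : Set} {f : A → A} → Injective _≡_ _≡_ f → ∀ {x i j} → i < j →
  fold x f i ≡ fold x f j → ∃[ r ] fold x f (suc r) ≡ x
fold-returns f-inj {i = zero}  {suc r} _   eq = r , sym eq
fold-returns f-inj {i = suc i} {suc j} i<j eq = fold-returns f-inj (s<s⁻¹ i<j) (f-inj eq)

-- By pigeonhole, two of the iterates with exponents 0 to `n` have the same code.
injective⇒periodic : {A : Set} → A ↣ Fin n → {f : A → A} → Injective _≡_ _≡_ f →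
  ∀ x → ∃[ r ] fold x f (suc r) ≡ x
injective⇒periodic {n} code {f} f-inj x =
  let i , j , i<j , eq = pigeonhole (n<1+n n) (λ i → to (fold x f (toℕ i)))
  in fold-returns f-inj i<j (injective eq)
  where open Injection code

module _ (A : FiniteSet) where

  open Inverse (FiniteSet.enum A)

  _≟ᶠ_ : DecidableEquality ⟨ A ⟩
  _≟ᶠ_ = inj⇒≟ (↔⇒↣ (FiniteSet.enum A))

  -- Supplies the smaller vertex set that remains when a redundant vertex `y` is dropped.
  omit : (y : ⟨ A ⟩) → ∃[ k ] k < ∣ A ∣ ×
    (Σ[ e ∈ (Fin k → ⟨ A ⟩) ] (∀ {x} → x ≢ y → ∃[ i ] e i ≡ x))
  omit y with e , hits ← enumerate (⊤ - to y) =
    _ , subst (Sub.∣ ⊤ - to y ∣ <_) (∣⊤∣≡n _) (x∈p⇒∣p-x∣<∣p∣ {x = to y} ∈⊤) , from ∘ e ,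
    λ {x} x≢y → map id (λ eq → trans (cong from eq) (strictlyInverseʳ x))
      (hits (x∈p∧x≢y⇒x∈p-y ∈⊤ (x≢y ∘ Injection.injective (↔⇒↣ (FiniteSet.enum A)))))

-- Some positive iterate of `π` on pairs returns to `(x , y)`. The given edge is the first iterate,
-- and `π-hom` carries it along the orbit back to `(x , y)`.
injective-endo-reflects : (G : Graph) {π : ⟨ V G ⟩ → ⟨ V G ⟩} → Injective _≡_ _≡_ π →
  (∀ {x y} → E G x y → E G (π x) (π y)) → ∀ {x y} → E G (π x) (π y) → E G x y
injective-endo-reflects G {π} π-inj π-hom {x} {y} e =
  let r , eq = injective⇒periodic (↔⇒↣ pairs) π²-inj (x , y)
  in subst (uncurry (E G)) eq (preserve r)
  where
  pairs : (⟨ V G ⟩ × ⟨ V G ⟩) ↔ Fin (∣ V G ∣ * ∣ V G ∣)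
  pairs = ↔-trans (FiniteSet.enum (V G) ×-↔ FiniteSet.enum (V G)) (↔-sym *↔×)

  π² : ⟨ V G ⟩ × ⟨ V G ⟩ → ⟨ V G ⟩ × ⟨ V G ⟩
  π² = map π π

  π²-inj : Injective _≡_ _≡_ π²
  π²-inj eq = let eq₁ , eq₂ = ,-injective eq in cong₂ _,_ (π-inj eq₁) (π-inj eq₂)

  preserve : ∀ r → uncurry (E G) (fold (x , y) π² (suc r))
  preserve zero    = e
  preserve (suc r) = π-hom (preserve r)

-- R-cores

-- The intermediate graph `C ∗ P` has vertex set `B` and is weakly equivalent to `C`, with `P`
-- leading to it and `Q` back, so minimality of the core applies.
rcore-factor-≤ : (C : Graph) → IsRCore C → {B : FiniteSet}
  (P : Relation (V C) B) (Q : Relation B (V C)) → FullDomain P → FullImage P → FullDomain Q →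
  Transforms (C ∗ P) C Q → ∣ V C ∣ ≤ ∣ B ∣
rcore-factor-≤ C core P Q P-dom P-img Q-dom CPQ =
  core (C ∗ P) ((Q , Q-dom , CPQ) , (P , P-dom , P-img , id , id))

-- Distinct twins would let `C` factor through an index set for the vertices other than `y`, with
-- `x` standing in for `y`.
rcore-thin : (C : Graph) → IsRCore C → {x y : ⟨ V C ⟩} →
  (∀ {z} → E C x z → E C y z) → (∀ {z} → E C y z → E C x z) → x ≡ y
rcore-thin C core {x} {y} x⇒y y⇒x with _≟ᶠ_ (V C) x y
... | yes x≡y = x≡y
... | no  x≢y with k , k<n , e , hits ← omit (V C) y =
  contradiction
    (rcore-factor-≤ C core P Q P-dom P-img (λ i → proj₁ (P-img i) , proj₂ (P-img i))
      (P-dom , CPQ⇒C , C⇒CPQ))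
    (<⇒≱ k<n)
  where
  B : FiniteSet
  B = record { Carrier = Fin k ; size = k ; enum = ↔-refl }

  -- Relates `u` to `i` when `u` and `e i` are equal or are the two twins, so that `u` and `e i`
  -- always have the same neighbours.
  P : Relation (V C) B
  P = record
    { rel  = λ u i → e i ≡ u ⊎ (e i ≡ x × u ≡ y) ⊎ (e i ≡ y × u ≡ x)
    ; rel? = λ u i → e i ≟ᵥ u ⊎-dec (e i ≟ᵥ x ×-dec u ≟ᵥ y) ⊎-dec (e i ≟ᵥ y ×-dec u ≟ᵥ x)
    }
    where _≟ᵥ_ = _≟ᶠ_ (V C)

  -- The converse of `P`: full domain and full image exchange roles.
  Q : Relation B (V C)
  Q = record { rel = λ i u → rel P u i ; rel? = λ i u → rel? P u i }

  P-dom : FullDomain P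
  P-dom u with _≟ᶠ_ (V C) u y
  ... | yes u≡y = map id (λ eq → inj₂ (inj₁ (eq , u≡y))) (hits x≢y)
  ... | no  u≢y = map id inj₁ (hits u≢y)

  P-img : FullImage P
  P-img i = e i , inj₁ refl

  P⇒ : ∀ {u i z} → rel P u i → E C u z → E C (e i) z
  P⇒ (inj₁ refl)                 = id
  P⇒ (inj₂ (inj₁ (eq , refl))) f rewrite eq = y⇒x f
  P⇒ (inj₂ (inj₂ (eq , refl))) f rewrite eq = x⇒y f

  P⇐ : ∀ {u i z} → rel P u i → E C (e i) z → E C u z
  P⇐ (inj₁ refl)                 = id
  P⇐ (inj₂ (inj₁ (eq , refl))) f rewrite eq = x⇒y f
  P⇐ (inj₂ (inj₂ (eq , refl))) f rewrite eq = y⇒x f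

  CPQ⇒C : ∀ {u v} → E ((C ∗ P) ∗ Q) u v → E C u v
  -- The ends of the edge are replaced one at a time by vertices with the same neighbours, first by
  -- the representatives in `B` and then by `v` and `u`.
  CPQ⇒C (_ , _ , (_ , _ , f , p , p′) , q , q′) =
    P⇐ q (E-sym C (P⇐ q′ (P⇒ p′ (E-sym C (P⇒ p f)))))

  C⇒CPQ : ∀ {u v} → E C u v → E ((C ∗ P) ∗ Q) u v
  C⇒CPQ {u} {v} f =
    let i , p = P-dom u
        j , q = P-dom v
    in i , j , (u , v , f , p , q) , p , q

-- The alternative in König's theorem is a cover with fewer elements than `C` has vertices, which
-- minimality excludes.
rcore-matching : (C : Graph) → IsRCore C → (T : Relation (V C) (V C)) → FullDomain T →
  Transforms C C T → ∃[ π ] Injective _≡_ _≡_ π × (∀ x → rel T x (π x))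
rcore-matching C core T T-dom (T-img , CT⇒C , C⇒CT) =
  [ fromMatching , ⊥-elim ∘ noCover ]′ (könig (λ i j → rel? T (from i) (from j)))
  where
  open Inverse (FiniteSet.enum (V C))

  T′ : REL (Fin ∣ V C ∣) (Fin ∣ V C ∣) 0ℓ
  T′ i j = rel T (from i) (from j)

  fromMatching : Matching T′ → ∃[ π ] Injective _≡_ _≡_ π × (∀ x → rel T x (π x))
  fromMatching (f , f-inj , f⊆T) = from ∘ f ∘ to ,
    (λ eq → Injection.injective (↔⇒↣ (FiniteSet.enum (V C)))
      (f-inj (Injection.injective (↔⇒↣ (↔-sym (FiniteSet.enum (V C)))) eq))) ,
    λ x → subst (λ u → rel T u (from (f (to x)))) (strictlyInverseʳ x) (f⊆T (to x))

  -- A vertex cover of T factors T through the disjoint union of its two parts.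
  noCover : ¬ Cover T′ ∣ V C ∣
  noCover c = <⇒≱ (size< c)
    (rcore-factor-≤ C core P Q P-dom P-img Q-dom (Q-img , CPQ⇒C , C⇒CPQ))
    where
    B : FiniteSet
    B = record
      { Carrier = Fin Sub.∣ rows c ∣ ⊎ Fin Sub.∣ cols c ∣
      ; size    = Sub.∣ rows c ∣ + Sub.∣ cols c ∣
      ; enum    = ↔-sym +↔⊎
      }

    row : Fin Sub.∣ rows c ∣ → ⟨ V C ⟩
    row = from ∘ proj₁ (enumerate (rows c))

    col : Fin Sub.∣ cols c ∣ → ⟨ V C ⟩
    col = from ∘ proj₁ (enumerate (cols c))

    cover : ∀ {x y} → rel T x y → (∃[ i ] row i ≡ x) ⊎ (∃[ j ] col j ≡ y)
    cover {x} {y} t = Sum.map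
      (map id (λ eq → trans (cong from eq) (strictlyInverseʳ x)) ∘ proj₂ (enumerate (rows c)))
      (map id (λ eq → trans (cong from eq) (strictlyInverseʳ y)) ∘ proj₂ (enumerate (cols c)))
      (covers c (subst₂ (rel T) (sym (strictlyInverseʳ x)) (sym (strictlyInverseʳ y)) t))

    -- A row stands for the source of a pair in `T`, a column for its target. Hence `P` is equality
    -- on rows and `T` on columns, while `Q` is `T` on rows and equality on columns.
    P : Relation (V C) B
    P = record
      { rel  = λ x → [ (λ i → row i ≡ x) , (λ j → rel T x (col j)) ]
      ; rel? = λ { x (inj₁ i) → _≟ᶠ_ (V C) (row i) x ; x (inj₂ j) → rel? T x (col j) }
      }

    Q : Relation B (V C)
    Q = record
      { rel  = λ b y → [ (λ i → rel T (row i) y) , (λ j → col j ≡ y) ] b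
      ; rel? = λ { (inj₁ i) y → rel? T (row i) y ; (inj₂ j) y → _≟ᶠ_ (V C) (col j) y }
      }

    PQ⇒T : ∀ {x b y} → rel P x b → rel Q b y → rel T x y
    PQ⇒T {b = inj₁ i} refl t    = t
    PQ⇒T {b = inj₂ j} t    refl = t

    T⇒PQ : ∀ {x y} → rel T x y → ∃[ b ] rel P x b × rel Q b y
    T⇒PQ t with cover t
    ... | inj₁ (i , refl) = inj₁ i , refl , t
    ... | inj₂ (j , refl) = inj₂ j , t , refl

    P-dom : FullDomain P
    P-dom x = let _ , t = T-dom x ; b , p , _ = T⇒PQ t in b , p

    P-img : FullImage P
    P-img (inj₁ i) = row i , refl
    P-img (inj₂ j) = T-img (col j)

    Q-dom : FullDomain Q
    Q-dom (inj₁ i) = T-dom (row i)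
    Q-dom (inj₂ j) = col j , refl

    Q-img : FullImage Q
    Q-img y = let _ , t = T-img y ; b , _ , q = T⇒PQ t in b , q

    CPQ⇒C : ∀ {u v} → E ((C ∗ P) ∗ Q) u v → E C u v
    CPQ⇒C (b , b′ , (x , y , f , p , p′) , q , q′) =
      CT⇒C (x , y , f , PQ⇒T {b = b} p q , PQ⇒T {b = b′} p′ q′)

    C⇒CPQ : ∀ {u v} → E C u v → E ((C ∗ P) ∗ Q) u v
    C⇒CPQ f =
      let x , y , f′ , t , t′ = C⇒CT f
          b  , p  , q  = T⇒PQ t
          b′ , p′ , q′ = T⇒PQ t′
      in b , b′ , (x , y , f′ , p , p′) , q , q′

-- Embedding the core as an induced subgraph

embedding⇒induced : (C G : Graph) (g : ⟨ V C ⟩ → ⟨ V G ⟩) → Injective _≡_ _≡_ g →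
  (∀ x y → E C x y ⇔ E G (g x) (g y)) → ∃[ U ] C ≅ G [ U ]
embedding⇒induced C G g g-inj g-emb = (λ a → ⌊ image? a ⌋) , record
  { bij = mk↔ₛ′
      (λ x → g x , fromWitness (x , refl))
      (λ (_ , p) → proj₁ (toWitness p))
      (λ (_ , p) → Σ-≡,≡→≡ (proj₂ (toWitness p) , T-irrelevant _ _))
      -- The search may find a preimage of `g x` other than the given `x`; injectivity identifies
      -- the two.
      (λ x → g-inj (proj₂ (toWitness {a? = image? (g x)} (fromWitness (x , refl)))))
  ; preserves = g-emb
  }
  where
  image? : ∀ a → Dec (∃[ x ] g x ≡ a)
  image? a = any-finite? (V C) λ x → _≟ᶠ_ (V G) (g x) a

theorem3p17 : (G C : Graph) → C IsRCoreOf G → ∃[ U ] C ≅ G [ U ]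
theorem3p17 G C (core , (R , R-dom , R-img , CR⇒G , G⇒CR) , (S , S-dom , S-img , GS⇒C , C⇒GS)) =
  embedding⇒induced C G g g-inj λ x y → mk⇔ g-hom (π-reflects ∘ S-edge)
  where
  T : Relation (V C) (V C)
  T = record
    { rel  = λ x y → ∃[ a ] rel R x a × rel S a y
    ; rel? = λ x y → any-finite? (V G) λ a → rel? R x a ×-dec rel? S a y
    }

  T-dom : FullDomain T
  T-dom x = let a , r = R-dom x ; y , s = S-dom a in y , a , r , s

  T-transforms : Transforms C C T
  T-transforms =
    (λ y → let a , s = S-img y ; x , r = R-img a in x , a , r , s) ,
    (λ (x , y , f , (a , r , s) , (b , r′ , s′)) →
      GS⇒C (a , b , CR⇒G (x , y , f , r , r′) , s , s′)) ,
    (λ f → let a , b , f′ , s , s′ = C⇒GS f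
               x , y , f″ , r , r′ = G⇒CR f′
           in x , y , f″ , (a , r , s) , (b , r′ , s′))

  matching : ∃[ π ] Injective _≡_ _≡_ π × (∀ x → rel T x (π x))
  matching = rcore-matching C core T T-dom T-transforms

  π : ⟨ V C ⟩ → ⟨ V C ⟩
  π = proj₁ matching

  g : ⟨ V C ⟩ → ⟨ V G ⟩
  g x = proj₁ (proj₂ (proj₂ matching) x)

  R-g : ∀ x → rel R x (g x)
  R-g x = proj₁ (proj₂ (proj₂ (proj₂ matching) x))

  S-g : ∀ x → rel S (g x) (π x)
  S-g x = proj₂ (proj₂ (proj₂ (proj₂ matching) x))

  g-hom : ∀ {x y} → E C x y → E G (g x) (g y)
  g-hom {x} {y} f = CR⇒G (x , y , f , R-g x , R-g y)

  S-edge : ∀ {x y} → E G (g x) (g y) → E C (π x) (π y)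
  S-edge {x} {y} f = GS⇒C (g x , g y , f , S-g x , S-g y)

  π-reflects : ∀ {x y} → E C (π x) (π y) → E C x y
  -- Passing through `G` by `g` and back by `S` shows that `π` preserves edges.
  π-reflects = injective-endo-reflects C (proj₁ (proj₂ matching)) (S-edge ∘ g-hom)

  g-inj : Injective _≡_ _≡_ g
  g-inj gx≡gy = rcore-thin C core (twins gx≡gy) (twins (sym gx≡gy))
    where
    twins : ∀ {x y} → g x ≡ g y → ∀ {z} → E C x z → E C y z
    -- The edge from `x` to `z` maps to one from `g x`, which is `g y`, to `g z`; `S` sends this to
    -- an edge from `π y` to `π z`, and `π` reflects it.
    twins eq {z} f = π-reflects (S-edge (subst (λ a → E G a (g z)) eq (g-hom f)))
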